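{- For every integer $k \ge 0$, \[ \sum_{p \in \mathbb{Z}} \sum_{q \in \mathbb{Z}} \binom{2k}{k+p} \binom{2k}{k+q}\, |p^2-q^2| = 2k^2{\binom{2k}{k}}^2 . \]
   Context: For integers $n \ge 0$ and $m$, the binomial coefficient $\binom{n}{m}$ is defined to be zero if $m < 0$ or $m > n$. With this convention, the sums over all integers $p$ and $q$ (positive, negative and zero) have only finitely many nonzero terms, namely those with $-k \le p \le k$ and $-k \le q \le k$. -}

module Defs where

open import Data.Nat.Base as ℕ using (ℕ; zero; suc; z≤n; s≤s; _<_)
open import Data.Nat.Combinatorics using (_C_; k>n⇒nCk≡0)
import Data.Nat.Properties as ℕ
open import Data.Integer.Base as ℤ using (ℤ; +_; -[1+_]; ∣_∣)
import Data.Integer.Properties as ℤ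
open import Data.Product.Base using (Σ-syntax; _,_)
open import Data.Sum.Base using (inj₁; inj₂)
open import Relation.Binary.PropositionalEquality
  using (_≡_; refl; sym; trans; cong; cong₂)

-- The case m > n is covered by the library's convention: n C m ≡ 0.
binom : ℕ → ℤ → ℕ
binom n (+ m)    = n C m
binom n -[1+ m ] = 0

FiniteSupport : (ℤ → ℕ) → Set
FiniteSupport f = Σ[ N ∈ ℕ ] (∀ p → N < ∣ p ∣ → f p ≡ 0)

-- f 0 + (f 1 + f (-1)) + … + (f N + f (-N))
∑[∣p∣≤_] : ℕ → (ℤ → ℕ) → ℕ
∑[∣p∣≤ zero  ] f = f (+ 0)
∑[∣p∣≤ suc N ] f = ∑[∣p∣≤ N ] f ℕ.+ (f (+ suc N) ℕ.+ f -[1+ N ])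

∑ℤ : (f : ℤ → ℕ) → FiniteSupport f → ℕ
∑ℤ f (N , _) = ∑[∣p∣≤ N ] f

private
  ∑-extend : ∀ f N d → (∀ p → N < ∣ p ∣ → f p ≡ 0) →
             ∑[∣p∣≤ d ℕ.+ N ] f ≡ ∑[∣p∣≤ N ] f
  ∑-extend f N zero    f≡0 = refl
  ∑-extend f N (suc d) f≡0 = trans
    (cong₂ ℕ._+_ (∑-extend f N d f≡0)
                 (cong₂ ℕ._+_ (f≡0 (+ suc (d ℕ.+ N)) (s≤s (ℕ.m≤n+m N d)))
                              (f≡0 -[1+ d ℕ.+ N ] (s≤s (ℕ.m≤n+m N d)))))
    (ℕ.+-identityʳ _)

  ∑-extend-≤ : ∀ f {N M} → N ℕ.≤ M → (∀ p → N < ∣ p ∣ → f p ≡ 0) →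
               ∑[∣p∣≤ M ] f ≡ ∑[∣p∣≤ N ] f
  ∑-extend-≤ f {N} {M} N≤M f≡0 = trans
    (cong (λ n → ∑[∣p∣≤ n ] f) (sym (ℕ.m∸n+n≡m N≤M)))
    (∑-extend f N (M ℕ.∸ N) f≡0)

-- ∑ℤ f does not depend on the chosen bound.
∑ℤ-irrelevant : ∀ f (s t : FiniteSupport f) → ∑ℤ f s ≡ ∑ℤ f t
∑ℤ-irrelevant f (N , f≡0) (M , f≡0′) with ℕ.≤-total N M
... | inj₁ N≤M = sym (∑-extend-≤ f N≤M f≡0)
... | inj₂ M≤N = ∑-extend-≤ f M≤N f≡0′

∑-zero : ∀ f N → (∀ p → f p ≡ 0) → ∑[∣p∣≤ N ] f ≡ 0
∑-zero f zero    f≡0 = f≡0 (+ 0)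
∑-zero f (suc N) f≡0 =
  cong₂ ℕ._+_ (∑-zero f N f≡0) (cong₂ ℕ._+_ (f≡0 (+ suc N)) (f≡0 -[1+ N ]))

binom-vanishes : ∀ k p → k < ∣ p ∣ → binom (2 ℕ.* k) (+ k ℤ.+ p) ≡ 0
binom-vanishes k (+ m) k<m =
  k>n⇒nCk≡0 (ℕ.+-monoʳ-< k (ℕ.≤-<-trans (ℕ.≤-reflexive (ℕ.+-identityʳ k)) k<m))
binom-vanishes k -[1+ m ] k<1+m@(s≤s k≤m) = cong (binom (2 ℕ.* k))
  (trans (ℤ.⊖-< k<1+m) (cong (λ n → ℤ.- (+ n)) (ℕ.+-∸-assoc 1 k≤m)))

summand : ℕ → ℤ → ℤ → ℕ
summand k p q =
  binom (2 ℕ.* k) (+ k ℤ.+ p) ℕ.* binom (2 ℕ.* k) (+ k ℤ.+ q)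
    ℕ.* ∣ p ℤ.^ 2 ℤ.- q ℤ.^ 2 ∣

summand-support : ∀ k p → FiniteSupport (λ q → summand k p q)
summand-support k p = k , λ q k<∣q∣ →
  cong (ℕ._* ∣ p ℤ.^ 2 ℤ.- q ℤ.^ 2 ∣)
    (trans (cong (binom (2 ℕ.* k) (+ k ℤ.+ p) ℕ.*_) (binom-vanishes k q k<∣q∣))
           (ℕ.*-zeroʳ (binom (2 ℕ.* k) (+ k ℤ.+ p))))

∑-summand-support : ∀ k →
  FiniteSupport (λ p → ∑ℤ (λ q → summand k p q) (summand-support k p))
∑-summand-support k = k , λ p k<∣p∣ → ∑-zero (summand k p) k λ q →
  cong (λ b → b ℕ.* binom (2 ℕ.* k) (+ k ℤ.+ q) ℕ.* ∣ p ℤ.^ 2 ℤ.- q ℤ.^ 2 ∣)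
    (binom-vanishes k p k<∣p∣)

{-# OPTIONS --safe #-}

-- Write c p = C(2k,k+p), m = n + 1, and let F n, A n be the sums of
-- c p c q |p² − q²| and of c p over |p|, |q| ≤ n.  Since
-- (k + m) c m = (k − n) c n, the quantity G n = (2n + 1)(k − n) c n telescopes,
-- and Σ_{|p|≤n} (2p² − k) c p = − G n.  This turns the increment F m − F n into
-- 2 c m ((2m² − k) A n + G n), and a second summation by parts shows that
-- k F n + k G n A n + (2k − 1)((k − n) c n)² does not depend on n.
-- Comparing n = 0 with n = k gives k F k = 2k³ (c 0)².
module Submission where

open import Defs
open import Data.Nat.Base as ℕ using (ℕ; zero; suc; _≤_; z≤n)
open import Data.Nat.Combinatorics
  using (_C_; nCn≡1; nCk≡nC[n∸k]; nCk+nC[k+1]≡[n+1]C[k+1])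
import Data.Nat.Properties as ℕ
import Data.Nat.Tactic.RingSolver as ℕ-Solver
open import Data.Integer.Base as ℤ using (ℤ; +_; -[1+_]; ∣_∣)
import Data.Integer.Properties as ℤ
import Data.Integer.Tactic.RingSolver as ℤ-Solver
open import Relation.Binary.PropositionalEquality
  using (_≡_; refl; sym; trans; cong; cong₂; module ≡-Reasoning)
open import Relation.Nullary using (yes; no)

open ≡-Reasoning

-- Symmetric sums and their growth

∑-cong : ∀ {f g} n → (∀ p → f p ≡ g p) → ∑[∣p∣≤ n ] f ≡ ∑[∣p∣≤ n ] g
∑-cong zero    f≗g = f≗g (+ 0)
∑-cong (suc n) f≗g =
  cong₂ ℕ._+_ (∑-cong n f≗g) (cong₂ ℕ._+_ (f≗g (+ suc n)) (f≗g -[1+ n ]))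

∑-distrib-+ : ∀ f g n →
  ∑[∣p∣≤ n ] (λ p → f p ℕ.+ g p) ≡ ∑[∣p∣≤ n ] f ℕ.+ ∑[∣p∣≤ n ] g
∑-distrib-+ f g zero    = refl
∑-distrib-+ f g (suc n) = trans
  (cong (ℕ._+ (f (+ suc n) ℕ.+ g (+ suc n) ℕ.+ (f -[1+ n ] ℕ.+ g -[1+ n ])))
        (∑-distrib-+ f g n))
  (rearrange (∑[∣p∣≤ n ] f) (∑[∣p∣≤ n ] g)
    (f (+ suc n)) (g (+ suc n)) (f -[1+ n ]) (g -[1+ n ]))
  where
  rearrange : ∀ s t u v w x →
    s ℕ.+ t ℕ.+ (u ℕ.+ v ℕ.+ (w ℕ.+ x)) ≡ s ℕ.+ (u ℕ.+ w) ℕ.+ (t ℕ.+ (v ℕ.+ x))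
  rearrange = ℕ-Solver.solve-∀

-- Enlarging the square adds two rows and two columns. By symmetry and evenness these four segments
-- have equal sums, and the four corners vanish because `f` is zero on the diagonal.
∑∑-suc : ∀ (f : ℤ → ℤ → ℕ) →
  (∀ p q → f p q ≡ f q p) →
  (∀ p n → f p -[1+ n ] ≡ f p (+ suc n)) →
  (∀ p → f p p ≡ 0) →
  ∀ n → ∑[∣p∣≤ suc n ] (λ p → ∑[∣p∣≤ suc n ] (f p)) ≡
        ∑[∣p∣≤ n ] (λ p → ∑[∣p∣≤ n ] (f p)) ℕ.+ 4 ℕ.* ∑[∣p∣≤ n ] (λ p → f p (+ suc n))
∑∑-suc f f-sym f-even f-diag n = begin
  ∑[∣p∣≤ n ] (λ p → ∑[∣p∣≤ n ] (f p) ℕ.+ (f p +m ℕ.+ f p -m))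
    ℕ.+ (∑[∣p∣≤ suc n ] (f +m) ℕ.+ ∑[∣p∣≤ suc n ] (f -m))
    ≡⟨ cong₂ ℕ._+_ inner (cong₂ ℕ._+_ row+ row-) ⟩
  F ℕ.+ (S ℕ.+ S) ℕ.+ (S ℕ.+ S)
    ≡⟨ collect F S ⟩
  F ℕ.+ 4 ℕ.* S ∎
  where
  +m = + suc n
  -m = -[1+ n ]
  F = ∑[∣p∣≤ n ] (λ p → ∑[∣p∣≤ n ] (f p))
  S = ∑[∣p∣≤ n ] (λ p → f p +m)

  collect : ∀ x y → x ℕ.+ (y ℕ.+ y) ℕ.+ (y ℕ.+ y) ≡ x ℕ.+ 4 ℕ.* y
  collect = ℕ-Solver.solve-∀

  f-even′ : ∀ q → f -m q ≡ f +m q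
  f-even′ q = trans (f-sym -m q) (trans (f-even q n) (f-sym q +m))

  inner : ∑[∣p∣≤ n ] (λ p → ∑[∣p∣≤ n ] (f p) ℕ.+ (f p +m ℕ.+ f p -m)) ≡
          F ℕ.+ (S ℕ.+ S)
  inner = begin
    ∑[∣p∣≤ n ] (λ p → ∑[∣p∣≤ n ] (f p) ℕ.+ (f p +m ℕ.+ f p -m))
      ≡⟨ ∑-distrib-+ _ _ n ⟩
    F ℕ.+ ∑[∣p∣≤ n ] (λ p → f p +m ℕ.+ f p -m)
      ≡⟨ cong (F ℕ.+_) (∑-distrib-+ _ _ n) ⟩
    F ℕ.+ (S ℕ.+ ∑[∣p∣≤ n ] (λ p → f p -m))
      ≡⟨ cong (λ s → F ℕ.+ (S ℕ.+ s)) (∑-cong n (λ p → f-even p n)) ⟩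
    F ℕ.+ (S ℕ.+ S) ∎

  row+ : ∑[∣p∣≤ suc n ] (f +m) ≡ S
  row+ = begin
    ∑[∣p∣≤ n ] (f +m) ℕ.+ (f +m +m ℕ.+ f +m -m)
      ≡⟨ cong₂ ℕ._+_ (∑-cong n (f-sym +m))
                     (cong₂ ℕ._+_ (f-diag +m) (trans (f-even +m n) (f-diag +m))) ⟩
    S ℕ.+ 0
      ≡⟨ ℕ.+-identityʳ S ⟩
    S ∎

  row- : ∑[∣p∣≤ suc n ] (f -m) ≡ S
  row- = trans (∑-cong (suc n) f-even′) row+

-- Absorption for binomial coefficients

nC0≡1 : ∀ n → n C 0 ≡ 1
nC0≡1 n = trans (nCk≡nC[n∸k] {0} {n} z≤n) (nCn≡1 n)

-- The absorption rule `(m+1) C(n,m+1) = (n−m) C(n,m)`, with the subtraction moved across so that it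
-- can be stated in ℕ for every `m`. Induction by Pascal's rule.
[m+1]nC[m+1]+m*nCm≡n*nCm : ∀ n m →
  suc m ℕ.* (n C suc m) ℕ.+ m ℕ.* (n C m) ≡ n ℕ.* (n C m)
[m+1]nC[m+1]+m*nCm≡n*nCm zero    zero    = refl
[m+1]nC[m+1]+m*nCm≡n*nCm zero    (suc m) =
  cong₂ ℕ._+_ (ℕ.*-zeroʳ (suc (suc m))) (ℕ.*-zeroʳ (suc m))
[m+1]nC[m+1]+m*nCm≡n*nCm (suc n) zero    = begin
  1 ℕ.* (suc n C 1) ℕ.+ 0
    ≡⟨ cong (λ x → 1 ℕ.* x ℕ.+ 0) (nCk+nC[k+1]≡[n+1]C[k+1] n 0) ⟨
  1 ℕ.* (n C 0 ℕ.+ n C 1) ℕ.+ 0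
    ≡⟨ expand (n C 0) (n C 1) ⟩
  n C 0 ℕ.+ (1 ℕ.* (n C 1) ℕ.+ 0)
    ≡⟨ cong (n C 0 ℕ.+_) ([m+1]nC[m+1]+m*nCm≡n*nCm n 0) ⟩
  suc n ℕ.* (n C 0)
    ≡⟨ cong (suc n ℕ.*_) (trans (nC0≡1 n) (sym (nC0≡1 (suc n)))) ⟩
  suc n ℕ.* (suc n C 0) ∎
  where
  expand : ∀ x y → 1 ℕ.* (x ℕ.+ y) ℕ.+ 0 ≡ x ℕ.+ (1 ℕ.* y ℕ.+ 0)
  expand = ℕ-Solver.solve-∀
[m+1]nC[m+1]+m*nCm≡n*nCm (suc n) (suc m) = begin
  suc (suc m) ℕ.* (suc n C suc (suc m)) ℕ.+ suc m ℕ.* (suc n C suc m)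
    ≡⟨ cong₂ (λ u v → suc (suc m) ℕ.* u ℕ.+ suc m ℕ.* v)
         (nCk+nC[k+1]≡[n+1]C[k+1] n (suc m)) (nCk+nC[k+1]≡[n+1]C[k+1] n m) ⟨
  suc (suc m) ℕ.* (y ℕ.+ z) ℕ.+ suc m ℕ.* (x ℕ.+ y)
    -- The terms are grouped into the induction hypotheses at `m + 1` and at `m`; the leftover
    -- `x + y` raises the factor `n` to `n + 1`.
    ≡⟨ expand m x y z ⟩
  (suc (suc m) ℕ.* z ℕ.+ suc m ℕ.* y) ℕ.+ (suc m ℕ.* y ℕ.+ m ℕ.* x) ℕ.+ (x ℕ.+ y)
    ≡⟨ cong₂ (λ u v → u ℕ.+ v ℕ.+ (x ℕ.+ y))
         ([m+1]nC[m+1]+m*nCm≡n*nCm n (suc m)) ([m+1]nC[m+1]+m*nCm≡n*nCm n m) ⟩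
  n ℕ.* y ℕ.+ n ℕ.* x ℕ.+ (x ℕ.+ y)
    ≡⟨ factor n x y ⟩
  suc n ℕ.* (x ℕ.+ y)
    ≡⟨ cong (suc n ℕ.*_) (nCk+nC[k+1]≡[n+1]C[k+1] n m) ⟩
  suc n ℕ.* (suc n C suc m) ∎
  where
  x = n C m
  y = n C suc m
  z = n C suc (suc m)

  expand : ∀ m x y z →
    (2 ℕ.+ m) ℕ.* (y ℕ.+ z) ℕ.+ (1 ℕ.+ m) ℕ.* (x ℕ.+ y) ≡
    ((2 ℕ.+ m) ℕ.* z ℕ.+ (1 ℕ.+ m) ℕ.* y) ℕ.+ ((1 ℕ.+ m) ℕ.* y ℕ.+ m ℕ.* x) ℕ.+ (x ℕ.+ y)
  expand = ℕ-Solver.solve-∀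

  factor : ∀ n x y →
    n ℕ.* y ℕ.+ n ℕ.* x ℕ.+ (x ℕ.+ y) ≡ (1 ℕ.+ n) ℕ.* (x ℕ.+ y)
  factor = ℕ-Solver.solve-∀

-- Polynomial identities and squares

-- The algebra of the induction step of `row-sum`, with `y` for `a (n+1)` and `D n` written as
-- `(k+n+1) y`. It rests on `G n − G (n+1) = 2 (2(n+1)² − k) y`.
row-step : ∀ k n m A x y →
  x ℤ.* ((+ 2 ℤ.* (m ℤ.* m) ℤ.- k) ℤ.* A ℤ.+ (+ 2 ℤ.* n ℤ.+ + 1) ℤ.* ((k ℤ.+ (+ 1 ℤ.+ n)) ℤ.* y))
    ℤ.+ + 4 ℤ.* (y ℤ.* x ℤ.* (m ℤ.* m ℤ.- (+ 1 ℤ.+ n) ℤ.* (+ 1 ℤ.+ n)))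
  ≡ x ℤ.* ((+ 2 ℤ.* (m ℤ.* m) ℤ.- k) ℤ.* (A ℤ.+ (y ℤ.+ y))
           ℤ.+ (+ 2 ℤ.* (+ 1 ℤ.+ n) ℤ.+ + 1) ℤ.* ((k ℤ.- (+ 1 ℤ.+ n)) ℤ.* y))
row-step = ℤ-Solver.solve-∀

-- The terms in `A` match by the telescoping of `G`. The terms in `y²` outside the squares sum to
-- `4k(n+1)(2k−1) y²`, which is `(2k−1)((D n)² − (D (n+1))²)`; this is the origin of the coefficient
-- `2k − 1`.
invariant-step : ∀ k n A y →
  k ℤ.* (+ 2 ℤ.* (y ℤ.* ((+ 2 ℤ.* ((+ 1 ℤ.+ n) ℤ.* (+ 1 ℤ.+ n)) ℤ.- k) ℤ.* A
                        ℤ.+ (+ 2 ℤ.* n ℤ.+ + 1) ℤ.* ((k ℤ.+ (+ 1 ℤ.+ n)) ℤ.* y))))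
    ℤ.+ k ℤ.* ((+ 2 ℤ.* (+ 1 ℤ.+ n) ℤ.+ + 1) ℤ.* ((k ℤ.- (+ 1 ℤ.+ n)) ℤ.* y)) ℤ.* (A ℤ.+ (y ℤ.+ y))
    ℤ.+ (+ 2 ℤ.* k ℤ.- + 1) ℤ.* (((k ℤ.- (+ 1 ℤ.+ n)) ℤ.* y) ℤ.* ((k ℤ.- (+ 1 ℤ.+ n)) ℤ.* y))
  ≡ k ℤ.* ((+ 2 ℤ.* n ℤ.+ + 1) ℤ.* ((k ℤ.+ (+ 1 ℤ.+ n)) ℤ.* y)) ℤ.* A
    ℤ.+ (+ 2 ℤ.* k ℤ.- + 1) ℤ.* (((k ℤ.+ (+ 1 ℤ.+ n)) ℤ.* y) ℤ.* ((k ℤ.+ (+ 1 ℤ.+ n)) ℤ.* y))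
invariant-step = ℤ-Solver.solve-∀

-[1+n]^2≡[1+n]^2 : ∀ n → -[1+ n ] ℤ.^ 2 ≡ (+ suc n) ℤ.^ 2
-[1+n]^2≡[1+n]^2 n = refl

i^2≡i*i : ∀ i → i ℤ.^ 2 ≡ i ℤ.* i
i^2≡i*i i = cong (i ℤ.*_) (ℤ.*-identityʳ i)

-- Here the absolute value disappears: the bound fixes the sign of the difference, leaving a
-- polynomial.
+∣i²-m²∣≡m²-i² : ∀ {i m} → i ≤ m →
  + ∣ (+ i) ℤ.^ 2 ℤ.- (+ m) ℤ.^ 2 ∣ ≡ (+ m) ℤ.* (+ m) ℤ.- (+ i) ℤ.* (+ i)
+∣i²-m²∣≡m²-i² {i} {m} i≤m = begin
  + ∣ (+ i) ℤ.^ 2 ℤ.- (+ m) ℤ.^ 2 ∣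
    ≡⟨ cong +_ (ℤ.∣i-j∣≡∣j-i∣ ((+ i) ℤ.^ 2) ((+ m) ℤ.^ 2)) ⟩
  + ∣ (+ m) ℤ.^ 2 ℤ.- (+ i) ℤ.^ 2 ∣
    ≡⟨ cong₂ (λ u v → + ∣ u ℤ.- v ∣) (i^2≡i*i (+ m)) (i^2≡i*i (+ i)) ⟩
  + ∣ (+ m) ℤ.* (+ m) ℤ.- (+ i) ℤ.* (+ i) ∣
    ≡⟨ ℤ.0≤i⇒+∣i∣≡i (ℤ.i≤j⇒0≤j-i squares-≤) ⟩
  (+ m) ℤ.* (+ m) ℤ.- (+ i) ℤ.* (+ i) ∎
  where
  squares-≤ : (+ i) ℤ.* (+ i) ℤ.≤ (+ m) ℤ.* (+ m)
  squares-≤ rewrite sym (ℤ.pos-* i i) | sym (ℤ.pos-* m m) =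
    ℤ.+≤+ (ℕ.*-mono-≤ i≤m i≤m)

-- Coefficients and summand for a fixed `k`

module _ (k : ℕ) where

  private
    K = + k

    c : ℤ → ℕ
    c p = binom (2 ℕ.* k) (K ℤ.+ p)

    a : ℕ → ℤ
    a n = + c (+ n)

    A : ℕ → ℤ
    A n = + ∑[∣p∣≤ n ] c

    D : ℕ → ℤ
    D n = (K ℤ.- + n) ℤ.* a n

    G : ℕ → ℤ
    G n = (+ 2 ℤ.* + n ℤ.+ + 1) ℤ.* D n

    F : ℕ → ℕ
    F n = ∑[∣p∣≤ n ] (λ p → ∑[∣p∣≤ n ] (summand k p))

    R : ℕ → ℕ → ℕ
    R m n = ∑[∣p∣≤ n ] (λ p → summand k p (+ m))

  binom-even : ∀ n → c -[1+ n ] ≡ c (+ suc n)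
  binom-even n with suc n ℕ.≤? k
  -- Outside the support both values are zero; inside, the reflection of row `2k` applies, where
  -- `k ∸ suc n` is a true subtraction.
  ... | no  n≮k = trans (binom-vanishes k -[1+ n ] (ℕ.≰⇒> n≮k))
                        (sym (binom-vanishes k (+ suc n) (ℕ.≰⇒> n≮k)))
  ... | yes n<k = begin
    binom (2 ℕ.* k) (k ℤ.⊖ suc n)
      ≡⟨ cong (binom (2 ℕ.* k)) (ℤ.⊖-≥ n<k) ⟩
    (2 ℕ.* k) C (k ℕ.∸ suc n)
      ≡⟨ nCk≡nC[n∸k] (ℕ.≤-trans (ℕ.m∸n≤m k (suc n)) (ℕ.m≤m+n k _)) ⟩
    (2 ℕ.* k) C (2 ℕ.* k ℕ.∸ (k ℕ.∸ suc n))
      ≡⟨ cong ((2 ℕ.* k) C_) reflected ⟩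
    (2 ℕ.* k) C (k ℕ.+ suc n) ∎
    where
    reflected : 2 ℕ.* k ℕ.∸ (k ℕ.∸ suc n) ≡ k ℕ.+ suc n
    reflected = begin
      k ℕ.+ (k ℕ.+ 0) ℕ.∸ (k ℕ.∸ suc n)
        ≡⟨ cong (λ x → k ℕ.+ x ℕ.∸ (k ℕ.∸ suc n)) (ℕ.+-identityʳ k) ⟩
      k ℕ.+ k ℕ.∸ (k ℕ.∸ suc n)
        ≡⟨ ℕ.+-∸-assoc k (ℕ.m∸n≤m k (suc n)) ⟩
      k ℕ.+ (k ℕ.∸ (k ℕ.∸ suc n))
        ≡⟨ cong (k ℕ.+_) (ℕ.m∸[m∸n]≡n n<k) ⟩
      k ℕ.+ suc n ∎

  -- Absorption in row `2k` at index `k + n`. It makes both `D n` and `D (n+1)` multiples of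
  -- `a (n+1)`, so the induction steps become polynomial identities.
  D≡[k+1+n]a[1+n] : ∀ n → D n ≡ (K ℤ.+ (+ 1 ℤ.+ + n)) ℤ.* a (suc n)
  D≡[k+1+n]a[1+n] n = begin
    (K ℤ.- + n) ℤ.* x
      ≡⟨ split K (+ n) x ⟩
    + 2 ℤ.* K ℤ.* x ℤ.- (K ℤ.+ + n) ℤ.* x
      ≡⟨ cong (ℤ._- (K ℤ.+ + n) ℤ.* x) absorbed ⟨
    ((K ℤ.+ (+ 1 ℤ.+ + n)) ℤ.* y ℤ.+ (K ℤ.+ + n) ℤ.* x) ℤ.- (K ℤ.+ + n) ℤ.* x
      ≡⟨ cancel _ _ ⟩
    (K ℤ.+ (+ 1 ℤ.+ + n)) ℤ.* y ∎
    where
    x = a n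
    y = a (suc n)

    split : ∀ k n x → (k ℤ.- n) ℤ.* x ≡ + 2 ℤ.* k ℤ.* x ℤ.- (k ℤ.+ n) ℤ.* x
    split = ℤ-Solver.solve-∀

    cancel : ∀ u v → (u ℤ.+ v) ℤ.- v ≡ u
    cancel = ℤ-Solver.solve-∀

    absorbed-ℕ : (k ℕ.+ suc n) ℕ.* c (+ suc n) ℕ.+ (k ℕ.+ n) ℕ.* c (+ n) ≡
                 2 ℕ.* k ℕ.* c (+ n)
    absorbed-ℕ rewrite ℕ.+-suc k n = [m+1]nC[m+1]+m*nCm≡n*nCm (2 ℕ.* k) (k ℕ.+ n)

    absorbed : (K ℤ.+ (+ 1 ℤ.+ + n)) ℤ.* y ℤ.+ (K ℤ.+ + n) ℤ.* x ≡ + 2 ℤ.* K ℤ.* x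
    absorbed = begin
      (+ (k ℕ.+ suc n)) ℤ.* y ℤ.+ (+ (k ℕ.+ n)) ℤ.* x
        ≡⟨ cong₂ ℤ._+_ (ℤ.pos-* (k ℕ.+ suc n) _) (ℤ.pos-* (k ℕ.+ n) _) ⟨
      + ((k ℕ.+ suc n) ℕ.* c (+ suc n) ℕ.+ (k ℕ.+ n) ℕ.* c (+ n))
        ≡⟨ cong +_ absorbed-ℕ ⟩
      + (2 ℕ.* k ℕ.* c (+ n))
        ≡⟨ ℤ.pos-* (2 ℕ.* k) _ ⟩
      + (2 ℕ.* k) ℤ.* x
        ≡⟨ cong (ℤ._* x) (ℤ.pos-* 2 k) ⟩
      + 2 ℤ.* K ℤ.* x ∎

  summand-sym : ∀ p q → summand k p q ≡ summand k q p
  summand-sym p q = cong₂ ℕ._*_ (ℕ.*-comm (c p) (c q)) (ℤ.∣i-j∣≡∣j-i∣ (p ℤ.^ 2) (q ℤ.^ 2))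

  summand-even : ∀ p n → summand k p -[1+ n ] ≡ summand k p (+ suc n)
  summand-even p n = cong₂ (λ u v → c p ℕ.* u ℕ.* ∣ p ℤ.^ 2 ℤ.- v ∣)
    (binom-even n) (-[1+n]^2≡[1+n]^2 n)

  summand-diag : ∀ p → summand k p p ≡ 0
  summand-diag p = trans
    (cong (λ i → c p ℕ.* c p ℕ.* ∣ i ∣) (ℤ.+-inverseʳ (p ℤ.^ 2)))
    (ℕ.*-zeroʳ (c p ℕ.* c p))

  A-suc : ∀ n → A (suc n) ≡ A n ℤ.+ (a (suc n) ℤ.+ a (suc n))
  A-suc n = cong (λ x → A n ℤ.+ (a (suc n) ℤ.+ + x)) (binom-even n)

  +summand : ∀ {i m} → i ≤ m →
    + summand k (+ i) (+ m) ≡ a i ℤ.* a m ℤ.* ((+ m) ℤ.* (+ m) ℤ.- (+ i) ℤ.* (+ i))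
  +summand {i} {m} i≤m = trans (ℤ.pos-* (c (+ i) ℕ.* c (+ m)) _)
    (cong₂ ℤ._*_ (ℤ.pos-* (c (+ i)) (c (+ m))) (+∣i²-m²∣≡m²-i² i≤m))

  -- Row sums and the invariant

  -- Since `n ≤ m`, each term is `c p · a m · (m² − p²)`, and the sum of `2p² c p` is `k A n − G n`.
  -- Doubling avoids a division.
  row-sum : ∀ {m} n → n ≤ m →
    + 2 ℤ.* + R m n ≡ a m ℤ.* ((+ 2 ℤ.* ((+ m) ℤ.* (+ m)) ℤ.- K) ℤ.* A n ℤ.+ G n)
  row-sum {m} zero    0≤m = trans (cong (λ u → + 2 ℤ.* u) (+summand 0≤m)) (base K (+ m) (a 0) (a m))
    where
    base : ∀ k m y x →
      + 2 ℤ.* (y ℤ.* x ℤ.* (m ℤ.* m ℤ.- + 0 ℤ.* + 0)) ≡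
      x ℤ.* ((+ 2 ℤ.* (m ℤ.* m) ℤ.- k) ℤ.* y ℤ.+ (+ 2 ℤ.* + 0 ℤ.+ + 1) ℤ.* ((k ℤ.- + 0) ℤ.* y))
    base = ℤ-Solver.solve-∀
  row-sum {m} (suc n) n<m = begin
    + 2 ℤ.* (+ R m n ℤ.+ (+ w ℤ.+ + w′))
      ≡⟨ cong (λ u → + 2 ℤ.* (+ R m n ℤ.+ (+ w ℤ.+ + u))) w′≡w ⟩
    + 2 ℤ.* (+ R m n ℤ.+ (+ w ℤ.+ + w))
      ≡⟨ distrib (+ R m n) (+ w) ⟩
    + 2 ℤ.* + R m n ℤ.+ + 4 ℤ.* + w
      ≡⟨ cong₂ (λ u v → u ℤ.+ + 4 ℤ.* v) (row-sum n (ℕ.<⇒≤ n<m)) (+summand n<m) ⟩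
    a m ℤ.* (M ℤ.* A n ℤ.+ (+ 2 ℤ.* + n ℤ.+ + 1) ℤ.* D n) ℤ.+ + 4 ℤ.* W
      ≡⟨ cong (λ d → a m ℤ.* (M ℤ.* A n ℤ.+ (+ 2 ℤ.* + n ℤ.+ + 1) ℤ.* d) ℤ.+ + 4 ℤ.* W)
           (D≡[k+1+n]a[1+n] n) ⟩
    a m ℤ.* (M ℤ.* A n ℤ.+ (+ 2 ℤ.* + n ℤ.+ + 1) ℤ.* ((K ℤ.+ (+ 1 ℤ.+ + n)) ℤ.* a (suc n)))
      ℤ.+ + 4 ℤ.* W
      ≡⟨ row-step K (+ n) (+ m) (A n) (a m) (a (suc n)) ⟩
    a m ℤ.* (M ℤ.* (A n ℤ.+ (a (suc n) ℤ.+ a (suc n))) ℤ.+ G (suc n))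
      ≡⟨ cong (λ u → a m ℤ.* (M ℤ.* u ℤ.+ G (suc n))) (A-suc n) ⟨
    a m ℤ.* (M ℤ.* A (suc n) ℤ.+ G (suc n)) ∎
    where
    M = + 2 ℤ.* ((+ m) ℤ.* (+ m)) ℤ.- K
    w = summand k (+ suc n) (+ m)
    w′ = summand k -[1+ n ] (+ m)
    W = a (suc n) ℤ.* a m ℤ.* ((+ m) ℤ.* (+ m) ℤ.- (+ suc n) ℤ.* (+ suc n))

    w′≡w : w′ ≡ w
    w′≡w = trans (summand-sym -[1+ n ] (+ m))
      (trans (summand-even (+ m) n) (summand-sym (+ m) (+ suc n)))

    distrib : ∀ r w → + 2 ℤ.* (r ℤ.+ (w ℤ.+ w)) ≡ + 2 ℤ.* r ℤ.+ + 4 ℤ.* w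
    distrib = ℤ-Solver.solve-∀

  -- The right side is the value at `n = 0`, where `F 0` is zero, `A 0` is `a 0`, and both `G 0` and
  -- `D 0` equal `k a 0`.
  invariant : ∀ n →
    K ℤ.* + F n ℤ.+ (K ℤ.* G n ℤ.* A n ℤ.+ (+ 2 ℤ.* K ℤ.- + 1) ℤ.* (D n ℤ.* D n)) ≡
    + 2 ℤ.* (K ℤ.* K ℤ.* K) ℤ.* (a 0 ℤ.* a 0)
  invariant zero    = trans
    (cong (λ z → K ℤ.* + z ℤ.+ (K ℤ.* G 0 ℤ.* A 0 ℤ.+ (+ 2 ℤ.* K ℤ.- + 1) ℤ.* (D 0 ℤ.* D 0)))
      (summand-diag (+ 0)))
    (base K (a 0))
    where
    base : ∀ k x →
      k ℤ.* + 0 ℤ.+ (k ℤ.* ((+ 2 ℤ.* + 0 ℤ.+ + 1) ℤ.* ((k ℤ.- + 0) ℤ.* x)) ℤ.* x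
        ℤ.+ (+ 2 ℤ.* k ℤ.- + 1) ℤ.* (((k ℤ.- + 0) ℤ.* x) ℤ.* ((k ℤ.- + 0) ℤ.* x))) ≡
      + 2 ℤ.* (k ℤ.* k ℤ.* k) ℤ.* (x ℤ.* x)
    base = ℤ-Solver.solve-∀
  invariant (suc n) = begin
    K ℤ.* + F (suc n) ℤ.+ (K ℤ.* G (suc n) ℤ.* A (suc n) ℤ.+ E ℤ.* DD)
      ≡⟨ cong₂ (λ u v → K ℤ.* u ℤ.+ (K ℤ.* G (suc n) ℤ.* v ℤ.+ E ℤ.* DD)) +F (A-suc n) ⟩
    K ℤ.* (+ F n ℤ.+ + 2 ℤ.* (+ 2 ℤ.* r)) ℤ.+ (K ℤ.* G (suc n) ℤ.* A′ ℤ.+ E ℤ.* DD)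
      ≡⟨ regroup K (+ F n) (+ 2 ℤ.* (+ 2 ℤ.* r)) (K ℤ.* G (suc n) ℤ.* A′) (E ℤ.* DD) ⟩
    K ℤ.* + F n ℤ.+ (K ℤ.* (+ 2 ℤ.* (+ 2 ℤ.* r)) ℤ.+ K ℤ.* G (suc n) ℤ.* A′ ℤ.+ E ℤ.* DD)
      ≡⟨ cong (λ u → K ℤ.* + F n ℤ.+ (K ℤ.* (+ 2 ℤ.* u) ℤ.+ K ℤ.* G (suc n) ℤ.* A′ ℤ.+ E ℤ.* DD))
           (row-sum n (ℕ.n≤1+n n)) ⟩
    K ℤ.* + F n ℤ.+ (K ℤ.* (+ 2 ℤ.* (y ℤ.* (M ℤ.* A n ℤ.+ (+ 2 ℤ.* + n ℤ.+ + 1) ℤ.* D n)))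
      ℤ.+ K ℤ.* G (suc n) ℤ.* A′ ℤ.+ E ℤ.* DD)
      ≡⟨ cong (λ u → K ℤ.* + F n ℤ.+ u) telescoped ⟩
    K ℤ.* + F n ℤ.+ (K ℤ.* G n ℤ.* A n ℤ.+ E ℤ.* (D n ℤ.* D n))
      ≡⟨ invariant n ⟩
    + 2 ℤ.* (K ℤ.* K ℤ.* K) ℤ.* (a 0 ℤ.* a 0) ∎
    where
    y = a (suc n)
    r = + R (suc n) n
    A′ = A n ℤ.+ (y ℤ.+ y)
    E = + 2 ℤ.* K ℤ.- + 1
    DD = D (suc n) ℤ.* D (suc n)
    M = + 2 ℤ.* ((+ suc n) ℤ.* (+ suc n)) ℤ.- K

    regroup : ∀ k f r g e →
      k ℤ.* (f ℤ.+ r) ℤ.+ (g ℤ.+ e) ≡ k ℤ.* f ℤ.+ (k ℤ.* r ℤ.+ g ℤ.+ e)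
    regroup = ℤ-Solver.solve-∀

    telescoped :
      K ℤ.* (+ 2 ℤ.* (y ℤ.* (M ℤ.* A n ℤ.+ (+ 2 ℤ.* + n ℤ.+ + 1) ℤ.* D n)))
        ℤ.+ K ℤ.* G (suc n) ℤ.* A′ ℤ.+ E ℤ.* DD ≡
      K ℤ.* G n ℤ.* A n ℤ.+ E ℤ.* (D n ℤ.* D n)
    telescoped rewrite D≡[k+1+n]a[1+n] n = invariant-step K (+ n) (A n) y

    +F : + F (suc n) ≡ + F n ℤ.+ + 2 ℤ.* (+ 2 ℤ.* r)
    +F = begin
      + F (suc n)
        ≡⟨ cong +_ (∑∑-suc (summand k) summand-sym summand-even summand-diag n) ⟩
      + F n ℤ.+ + (4 ℕ.* R (suc n) n)
        ≡⟨ cong (λ u → + F n ℤ.+ u) (ℤ.pos-* 4 (R (suc n) n)) ⟩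
      + F n ℤ.+ + 4 ℤ.* r
        -- The factor 4 is split because `row-sum` evaluates twice the row.
        ≡⟨ cong (λ u → + F n ℤ.+ u) (ℤ.*-assoc (+ 2) (+ 2) r) ⟩
      + F n ℤ.+ + 2 ℤ.* (+ 2 ℤ.* r) ∎

  -- Evaluation at `n = k`

  -- At `n = k` both `D` and `G` contain the factor `k − k`, so only `k F k` survives in the
  -- invariant.
  k*F[k] : K ℤ.* + F k ≡ K ℤ.* (+ 2 ℤ.* (K ℤ.* K) ℤ.* (a 0 ℤ.* a 0))
  k*F[k] = begin
    K ℤ.* + F k
      ≡⟨ boundary K (+ F k) (a k) (A k) ⟨
    K ℤ.* + F k ℤ.+ (K ℤ.* G k ℤ.* A k ℤ.+ (+ 2 ℤ.* K ℤ.- + 1) ℤ.* (D k ℤ.* D k))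
      ≡⟨ invariant k ⟩
    + 2 ℤ.* (K ℤ.* K ℤ.* K) ℤ.* (a 0 ℤ.* a 0)
      ≡⟨ factor K (a 0) ⟩
    K ℤ.* (+ 2 ℤ.* (K ℤ.* K) ℤ.* (a 0 ℤ.* a 0)) ∎
    where
    boundary : ∀ k f x s →
      k ℤ.* f ℤ.+ (k ℤ.* ((+ 2 ℤ.* k ℤ.+ + 1) ℤ.* ((k ℤ.- k) ℤ.* x)) ℤ.* s
        ℤ.+ (+ 2 ℤ.* k ℤ.- + 1) ℤ.* (((k ℤ.- k) ℤ.* x) ℤ.* ((k ℤ.- k) ℤ.* x))) ≡ k ℤ.* f
    boundary = ℤ-Solver.solve-∀

    factor : ∀ k x → + 2 ℤ.* (k ℤ.* k ℤ.* k) ℤ.* (x ℤ.* x) ≡ k ℤ.* (+ 2 ℤ.* (k ℤ.* k) ℤ.* (x ℤ.* x))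
    factor = ℤ-Solver.solve-∀

  +[2k²a₀²] : + (2 ℕ.* k ℕ.^ 2 ℕ.* ((2 ℕ.* k) C k) ℕ.^ 2) ≡
              + 2 ℤ.* (K ℤ.* K) ℤ.* (a 0 ℤ.* a 0)
  +[2k²a₀²] = begin
    + (2 ℕ.* k ℕ.^ 2 ℕ.* x ℕ.^ 2)
      ≡⟨ cong₂ (λ u v → + (2 ℕ.* (k ℕ.* u) ℕ.* (x ℕ.* v))) (ℕ.*-identityʳ k) (ℕ.*-identityʳ x) ⟩
    + (2 ℕ.* (k ℕ.* k) ℕ.* (x ℕ.* x))
      ≡⟨ ℤ.pos-* (2 ℕ.* (k ℕ.* k)) (x ℕ.* x) ⟩
    + (2 ℕ.* (k ℕ.* k)) ℤ.* + (x ℕ.* x)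
      ≡⟨ cong₂ ℤ._*_ (trans (ℤ.pos-* 2 (k ℕ.* k)) (cong (λ u → + 2 ℤ.* u) (ℤ.pos-* k k))) (ℤ.pos-* x x) ⟩
    + 2 ℤ.* (K ℤ.* K) ℤ.* (+ x ℤ.* + x)
      -- `a 0` is the coefficient at index `k + 0`, which does not reduce to `k`.
      ≡⟨ cong (λ j → + 2 ℤ.* (K ℤ.* K) ℤ.* (+ ((2 ℕ.* k) C j) ℤ.* + ((2 ℕ.* k) C j)))
           (ℕ.+-identityʳ k) ⟨
    + 2 ℤ.* (K ℤ.* K) ℤ.* (a 0 ℤ.* a 0) ∎
    where
    x = (2 ℕ.* k) C k

theorem1 : ∀ (k : ℕ) →
    ∑ℤ (λ p → ∑ℤ (λ q → binom (2 ℕ.* k) (+ k ℤ.+ p) ℕ.* binom (2 ℕ.* k) (+ k ℤ.+ q) ℕ.* ∣ p ℤ.^ 2 ℤ.- q ℤ.^ 2 ∣)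
                 (summand-support k p))
       (∑-summand-support k)
      ≡ 2 ℕ.* k ℕ.^ 2 ℕ.* binom (2 ℕ.* k) (+ k) ℕ.^ 2
-- The invariant carries a factor `k` and says nothing here; the only term, at `p = q = 0`, computes
-- to zero.
theorem1 zero       = refl
-- The nested `∑ℤ` unfolds to `F k`, since both supports carry the bound `k`; the nonzero factor `k`
-- is then cancelled.
theorem1 k@(suc _) = ℤ.+-injective (trans
  (ℤ.*-cancelˡ-≡ (+ k) _ _ (k*F[k] k))
  (sym (+[2k²a₀²] k)))
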